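{- There is an absolute constant $C>0$ such that for every positive integer $n$ and every set $A \subseteq \{0,1\}^n$ with $|A| = 2^{n-1}$ there exists a bijection $\phi \colon \{0,1\}^{n-1} \to A$ with $\mathrm{avgstretch}(\phi) \le C\sqrt{n}$.
   Context: $\mathrm{dist}$ denotes the Hamming distance. For a bijection $\phi \colon \{0,1\}^{n-1} \to A$, where $A \subseteq \{0,1\}^n$, the average stretch is $\mathrm{avgstretch}(\phi) = \mathbb{E}[\mathrm{dist}(\phi(x),\phi(x'))]$, where the expectation is over a uniformly random pair $x,x' \in \{0,1\}^{n-1}$ differing in exactly one coordinate (equivalently, $x$ uniform in $\{0,1\}^{n-1}$ and $x' = x+e_i$ with $i$ uniform in $[n-1]$). -}

module Defs where

open import Data.Bool using (Bool; true; false; not; if_then_else_)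
open import Data.Nat using (ℕ; zero; suc; _+_; _*_)
open import Data.Fin using (Fin; zero; suc)
open import Data.Vec using (Vec; []; _∷_; lookup; updateAt)
open import Data.List using (List; []; _∷_; map; _++_; allFin)
open import Data.Nat.ListAction using (sum)

dist : ∀ {n} → Vec Bool n → Vec Bool n → ℕ
dist [] [] = 0
dist (a ∷ xs) (b ∷ ys) = (if a Data.Bool.xor b then 1 else 0) + dist xs ys

flipAt : ∀ {n} → Fin n → Vec Bool n → Vec Bool n
flipAt i x = updateAt x i not

cube : (n : ℕ) → List (Vec Bool n)
cube zero = [] ∷ []
cube (suc n) = map (true ∷_) (cube n) ++ map (false ∷_) (cube n)

-- Sum of dist(φ x, φ (x + e_i)) over all x ∈ {0,1}^m and i ∈ [m].
-- avgstretch φ = stretchSum φ / (m * 2^m).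
stretchSum : ∀ {m k} → (Vec Bool m → Vec Bool k) → ℕ
stretchSum {m} φ = sum (map (λ x → sum (map (λ i → dist (φ x) (φ (flipAt i x))) (allFin m))) (cube m))

{-# OPTIONS --safe #-}
-- The set A and the subcube {0} × {0,1}^{n-1} have the same size, so by the triangle inequality
-- it suffices to match two equally large subsets of {0,1}^n with average distance O(√n).
-- Take s ≈ √n and forget the last s coordinates, at cost s per point: a set becomes a load
-- f : {0,1}^r → {0,…,2^s} with r = n − s.  Replace f successively by its averages (rounded to
-- integers) along each coordinate.  Averaging loads a and b moves d ≈ |a − b| / 2 points and lowers
-- the energy Σ f² by about 2 d², so by Cauchy–Schwarz all the moves together cost O(√n 2^n).
-- In the end the load is constant up to r, because each rounding widens its range by at most one.
-- Two such loads with the same total differ by at most 2r pointwise, and repairing this moves at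
-- most 2r 2^r points by at most n each, which is negligible against 2^n = 2^r 2^s.

module Submission where

open import Defs
open import Algebra.Bundles using (CommutativeMonoid)
import Algebra.Properties.CommutativeSemigroup as CommutativeSemigroupProperties
open import Data.Bool using (Bool; true; false)
open import Data.Nat using (ℕ; zero; suc; _+_; _*_; _∸_; _⊓_; _^_; _≤_; _<_; z≤n; s≤s; ⌊_/2⌋; ⌈_/2⌉)
open import Data.Nat.Properties
open import Data.Nat.ListAction using (sum)
open import Data.Nat.ListAction.Properties using (sum-++)
open import Data.Nat.Tactic.RingSolver using (solve-∀)
open import Data.Fin using (Fin; zero; suc)
open import Data.Vec as Vec using (Vec; []; _∷_)
open import Data.List using (List; []; _∷_; _++_; map; length; replicate; concatMap; allFin; take; drop)
open import Data.List.Properties using (map-++; map-∘; map-cong; length-map; length-++; length-replicate; map-replicate; length-tabulate; length-take; length-drop; take++drop≡id; concatMap-map; concatMap-++; map-concatMap; concatMap-cong)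
open import Data.List.Membership.Propositional using (_∈_)
open import Data.List.Membership.Propositional.Properties using (∈-map⁺; ∈-map⁻; ∈-++⁺ˡ; ∈-++⁺ʳ)
open import Data.List.Relation.Unary.Any using (here; there)
open import Data.List.Relation.Unary.All as All using ([]; _∷_)
import Data.List.Relation.Unary.All.Properties as All
open import Data.List.Relation.Unary.AllPairs using ([]; _∷_)
open import Data.List.Relation.Unary.Unique.Propositional using (Unique)
import Data.List.Relation.Unary.Unique.Propositional.Properties as Unique
open import Data.List.Relation.Binary.Permutation.Propositional using (_↭_; refl; prep; swap; trans; ↭-refl; ↭-sym; ↭-trans; ↭-reflexive; ↭⇒↭ₛ)
open import Data.List.Relation.Binary.Permutation.Propositional.Properties using (++-commutativeMonoid; ++⁺; shift; ↭-length; ∈-resp-↭; All-resp-↭; map⁺)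
import Data.List.Relation.Binary.Permutation.Setoid.Properties as PermutationSetoid
open import Data.Product using (Σ; ∃; _×_; _,_; proj₁; proj₂)
open import Data.Sum using (inj₁; inj₂)
open import Data.Empty using (⊥-elim)
open import Function using (_∘_; const)
open import Relation.Binary.PropositionalEquality using (_≡_; refl; sym; cong; cong₂; subst; subst₂; setoid; module ≡-Reasoning) renaming (trans to ≡-trans)

private
  variable
    I J : Set
    k n r c d : ℕ

-- Sums over lists

Σ[_] : List I → (I → ℕ) → ℕ
Σ[ is ] f = sum (map f is)

Σ-mono : ∀ (is : List I) {f g} → (∀ i → f i ≤ g i) → Σ[ is ] f ≤ Σ[ is ] g
Σ-mono []       le = z≤n
Σ-mono (i ∷ is) le = +-mono-≤ (le i) (Σ-mono is le)

Σ-cong : ∀ (is : List I) {f g} → (∀ i → f i ≡ g i) → Σ[ is ] f ≡ Σ[ is ] g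
Σ-cong is eq = cong sum (map-cong eq is)

Σ-+ : ∀ (is : List I) f g → Σ[ is ] (λ i → f i + g i) ≡ Σ[ is ] f + Σ[ is ] g
Σ-+ []       f g = refl
Σ-+ (i ∷ is) f g rewrite Σ-+ is f g = lemma (f i) (g i) (Σ[ is ] f) (Σ[ is ] g)
  where
  lemma : ∀ a b x y → (a + b) + (x + y) ≡ (a + x) + (b + y)
  lemma = solve-∀

Σ-const : ∀ (is : List I) c → Σ[ is ] (const c) ≡ length is * c
Σ-const []       c = refl
Σ-const (i ∷ is) c = cong (c +_) (Σ-const is c)

Σ-swap : ∀ (is : List I) (js : List J) (f : I → J → ℕ) →
         Σ[ is ] (λ i → Σ[ js ] (f i)) ≡ Σ[ js ] (λ j → Σ[ is ] (λ i → f i j))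
Σ-swap []       js f = sym (≡-trans (Σ-const js 0) (*-zeroʳ (length js)))
Σ-swap (i ∷ is) js f rewrite Σ-swap is js f = sym (Σ-+ js (f i) (λ j → Σ[ is ] (λ i → f i j)))

Σ-cube : ∀ r (f : Vec Bool (suc r) → ℕ) →
         Σ[ cube (suc r) ] f ≡ Σ[ cube r ] (f ∘ (true ∷_)) + Σ[ cube r ] (f ∘ (false ∷_))
Σ-cube r f rewrite map-++ f (map (true ∷_) (cube r)) (map (false ∷_) (cube r))
                 | sum-++ (map f (map (true ∷_) (cube r))) (map f (map (false ∷_) (cube r)))
                 | map-∘ {g = f} {f = true ∷_} (cube r)
                 | map-∘ {g = f} {f = false ∷_} (cube r) = refl

length-cube : ∀ r → length (cube r) ≡ 2 ^ r
length-cube zero = refl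
length-cube (suc r) =
  ≡-trans (length-++ (map (true ∷_) (cube r)))
    (cong₂ _+_ (≡-trans (length-map _ (cube r)) (length-cube r))
               (≡-trans (length-map _ (cube r)) (≡-trans (length-cube r) (sym (+-identityʳ (2 ^ r))))))

∈-cube : (x : Vec Bool r) → x ∈ cube r
∈-cube []          = here refl
∈-cube (true ∷ x)  = ∈-++⁺ˡ (∈-map⁺ (true ∷_) (∈-cube x))
∈-cube (false ∷ x) = ∈-++⁺ʳ _ (∈-map⁺ (false ∷_) (∈-cube x))

-- Flipping a coordinate permutes the cube; for the first coordinate it exchanges the two halves in
-- `Σ-cube`.
Σ-flipAt : ∀ (i : Fin r) (f : Vec Bool r → ℕ) → Σ[ cube r ] (f ∘ flipAt i) ≡ Σ[ cube r ] f
Σ-flipAt {suc r} zero f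
  rewrite Σ-cube r (f ∘ flipAt zero) | Σ-cube r f = +-comm (Σ[ cube r ] (f ∘ (false ∷_))) _
Σ-flipAt {suc r} (suc i) f
  rewrite Σ-cube r (f ∘ flipAt (suc i)) | Σ-cube r f =
  cong₂ _+_ (Σ-flipAt i (f ∘ (true ∷_))) (Σ-flipAt i (f ∘ (false ∷_)))

-- The Hamming distance

dist-refl : (x : Vec Bool n) → dist x x ≡ 0
dist-refl []          = refl
dist-refl (true ∷ x)  = dist-refl x
dist-refl (false ∷ x) = dist-refl x

dist-sym : (x y : Vec Bool n) → dist x y ≡ dist y x
dist-sym []          []          = refl
dist-sym (true ∷ x)  (true ∷ y)  = dist-sym x y
dist-sym (true ∷ x)  (false ∷ y) = cong suc (dist-sym x y)
dist-sym (false ∷ x) (true ∷ y)  = cong suc (dist-sym x y)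
dist-sym (false ∷ x) (false ∷ y) = dist-sym x y

dist-triangle : (x y z : Vec Bool n) → dist x z ≤ dist x y + dist y z
dist-triangle [] [] [] = z≤n
dist-triangle (true ∷ x) (true ∷ y) (true ∷ z) = dist-triangle x y z
dist-triangle (true ∷ x) (true ∷ y) (false ∷ z) =
  ≤-trans (s≤s (dist-triangle x y z)) (≤-reflexive (sym (+-suc (dist x y) (dist y z))))
dist-triangle (true ∷ x) (false ∷ y) (true ∷ z) =
  m≤n⇒m≤1+n (≤-trans (dist-triangle x y z) (+-monoʳ-≤ (dist x y) (n≤1+n (dist y z))))
dist-triangle (true ∷ x) (false ∷ y) (false ∷ z) = s≤s (dist-triangle x y z)
dist-triangle (false ∷ x) (true ∷ y) (true ∷ z) = s≤s (dist-triangle x y z)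
dist-triangle (false ∷ x) (true ∷ y) (false ∷ z) =
  m≤n⇒m≤1+n (≤-trans (dist-triangle x y z) (+-monoʳ-≤ (dist x y) (n≤1+n (dist y z))))
dist-triangle (false ∷ x) (false ∷ y) (true ∷ z) =
  ≤-trans (s≤s (dist-triangle x y z)) (≤-reflexive (sym (+-suc (dist x y) (dist y z))))
dist-triangle (false ∷ x) (false ∷ y) (false ∷ z) = dist-triangle x y z

dist-≤ : (x y : Vec Bool n) → dist x y ≤ n
dist-≤ []          []          = z≤n
dist-≤ (true ∷ x)  (true ∷ y)  = m≤n⇒m≤1+n (dist-≤ x y)
dist-≤ (true ∷ x)  (false ∷ y) = s≤s (dist-≤ x y)
dist-≤ (false ∷ x) (true ∷ y)  = s≤s (dist-≤ x y)
dist-≤ (false ∷ x) (false ∷ y) = m≤n⇒m≤1+n (dist-≤ x y)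

dist-∷ : ∀ b (x y : Vec Bool n) → dist (b ∷ x) (b ∷ y) ≡ dist x y
dist-∷ true  x y = refl
dist-∷ false x y = refl

dist-flipAt : ∀ i (x : Vec Bool n) → dist x (flipAt i x) ≡ 1
dist-flipAt zero    (true ∷ x)  = cong suc (dist-refl x)
dist-flipAt zero    (false ∷ x) = cong suc (dist-refl x)
dist-flipAt (suc i) (b ∷ x) = ≡-trans (dist-∷ b x (flipAt i x)) (dist-flipAt i x)

-- Transport between finite multisets

-- The index is any upper bound for the sum of the distances between entries in equal positions, so
-- that costs can be weakened and added freely.
data Aligned {n} : List (Vec Bool n) → List (Vec Bool n) → ℕ → Set where
  []  : Aligned [] [] c
  _∷_ : ∀ {x y xs ys} → dist x y + d ≤ c → Aligned xs ys d → Aligned (x ∷ xs) (y ∷ ys) c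

-- A perfect matching of two multisets. Only the target is reordered: the order of the source
-- survives, and a bijection is read off from it at the end.
Transport : List (Vec Bool n) → List (Vec Bool n) → ℕ → Set
Transport xs ys c = ∃ λ zs → Aligned xs zs c × zs ↭ ys

private
  variable
    ws xs ys zs : List (Vec Bool n)

Aligned-weaken : c ≤ d → Aligned xs ys c → Aligned xs ys d
Aligned-weaken le []       = []
Aligned-weaken le (p ∷ ps) = ≤-trans p le ∷ ps

Aligned-refl : (xs : List (Vec Bool n)) → Aligned xs xs 0
Aligned-refl []       = []
Aligned-refl (x ∷ xs) = ≤-reflexive (≡-trans (+-identityʳ _) (dist-refl x)) ∷ Aligned-refl xs

Aligned-sym : Aligned xs ys c → Aligned ys xs c
Aligned-sym [] = []
Aligned-sym (_∷_ {x = x} {y} p ps) =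
  ≤-trans (≤-reflexive (cong (_+ _) (dist-sym y x))) p ∷ Aligned-sym ps

Aligned-trans : Aligned xs ys c → Aligned ys zs d → Aligned xs zs (c + d)
Aligned-trans [] [] = []
Aligned-trans (_∷_ {d = c} {x = x} {y} p ps) (_∷_ {d = d} {y = z} q qs) =
  ≤-trans (+-monoˡ-≤ (c + d) (dist-triangle x y z))
    (≤-trans (≤-reflexive (lemma (dist x y) (dist y z) c d)) (+-mono-≤ p q))
  ∷ Aligned-trans ps qs
  where
  lemma : ∀ a b x y → (a + b) + (x + y) ≡ (a + x) + (b + y)
  lemma = solve-∀

Aligned-++ : Aligned xs ys c → Aligned ws zs d → Aligned (xs ++ ws) (ys ++ zs) (c + d)
Aligned-++ [] qs = Aligned-weaken (m≤n+m _ _) qs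
Aligned-++ {d = d} (_∷_ {d = c} {x = x} {y} p ps) qs =
  ≤-trans (≤-reflexive (sym (+-assoc (dist x y) c d))) (+-monoˡ-≤ d p) ∷ Aligned-++ ps qs

-- Each partner follows its point through the permutation, so the same pairs stay matched. This lets
-- a `Transport` be reversed and composed.
Aligned-↭ : xs ↭ ws → Aligned xs ys c → ∃ λ zs → ys ↭ zs × Aligned ws zs c
Aligned-↭ refl ps = _ , ↭-refl , ps
Aligned-↭ (prep x π) (p ∷ ps) with Aligned-↭ π ps
... | zs , σ , qs = _ , prep _ σ , p ∷ qs
Aligned-↭ (swap x₁ x₂ π) (_∷_ {c = c} {y = y₁} p₁ (_∷_ {d = d} {y = y₂} p₂ ps)) with Aligned-↭ π ps
... | zs , σ , qs = _ , swap _ _ σ , le ∷ (≤-refl ∷ qs)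
  where
  lemma : ∀ a b e → a + (b + e) ≡ b + (a + e)
  lemma = solve-∀
  le : dist x₂ y₂ + (dist x₁ y₁ + d) ≤ c
  le = ≤-trans (≤-reflexive (lemma (dist x₂ y₂) (dist x₁ y₁) d)) (≤-trans (+-monoʳ-≤ (dist x₁ y₁) p₂) p₁)
Aligned-↭ (trans π ρ) ps with Aligned-↭ π ps
... | zs , σ , qs with Aligned-↭ ρ qs
... | us , τ , rs = us , trans σ τ , rs

Transport-weaken : c ≤ d → Transport xs ys c → Transport xs ys d
Transport-weaken le (zs , ps , π) = zs , Aligned-weaken le ps , π

Transport-↭ : xs ↭ ys → Transport xs ys 0
Transport-↭ {xs = xs} π = xs , Aligned-refl xs , π

Transport-sym : Transport xs ys c → Transport ys xs c
Transport-sym (zs , ps , π) with Aligned-↭ π (Aligned-sym ps)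
... | us , σ , qs = us , qs , ↭-sym σ

Transport-trans : Transport xs ys c → Transport ys zs d → Transport xs zs (c + d)
Transport-trans (us , ps , π) (vs , qs , ρ) with Aligned-↭ (↭-sym π) qs
... | ws , σ , rs = ws , Aligned-trans ps rs , ↭-trans (↭-sym σ) ρ

Transport-++ : Transport xs ys c → Transport ws zs d → Transport (xs ++ ws) (ys ++ zs) (c + d)
Transport-++ (us , ps , π) (vs , qs , ρ) = us ++ vs , Aligned-++ ps qs , ++⁺ π ρ

Transport-resp : ∀ {xs′ ys′ : List (Vec Bool n)} → xs ↭ xs′ → ys′ ↭ ys →
                 Transport xs′ ys′ c → Transport xs ys c
Transport-resp {c = c} π ρ t =
  Transport-weaken (≤-reflexive (+-identityʳ c))
    (Transport-trans (Transport-trans (Transport-↭ π) t) (Transport-↭ ρ))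

Aligned-∷ : ∀ b → Aligned xs ys c → Aligned (map (b ∷_) xs) (map (b ∷_) ys) c
Aligned-∷ b [] = []
Aligned-∷ b (_∷_ {x = x} {y} p ps) =
  ≤-trans (≤-reflexive (cong (_+ _) (dist-∷ b x y))) p ∷ Aligned-∷ b ps

Transport-∷ : ∀ b → Transport xs ys c → Transport (map (b ∷_) xs) (map (b ∷_) ys) c
Transport-∷ b (zs , ps , π) = map (b ∷_) zs , Aligned-∷ b ps , map⁺ (b ∷_) π

Transport-length : Transport xs ys c → length xs ≡ length ys
Transport-length (zs , ps , π) = ≡-trans (go ps) (↭-length π)
  where
  go : ∀ {xs zs : List (Vec Bool n)} → Aligned xs zs c → length xs ≡ length zs
  go []       = refl
  go (p ∷ ps) = cong suc (go ps)

Transport-any : (xs ys : List (Vec Bool n)) → length xs ≡ length ys → Transport xs ys (length xs * n)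
Transport-any xs ys eq = ys , go xs ys eq , ↭-refl
  where
  go : (xs ys : List (Vec Bool n)) → length xs ≡ length ys → Aligned xs ys (length xs * n)
  go []       []       eq = []
  go (x ∷ xs) (y ∷ ys) eq = +-monoˡ-≤ _ (dist-≤ x y) ∷ go xs ys (suc-injective eq)

Aligned-Σ : ∀ (is : List I) (u v : I → Vec Bool n) →
            Aligned (map u is) (map v is) c → Σ[ is ] (λ i → dist (u i) (v i)) ≤ c
Aligned-Σ []       u v []       = z≤n
Aligned-Σ (i ∷ is) u v (p ∷ ps) = ≤-trans (+-monoʳ-≤ (dist (u i) (v i)) (Aligned-Σ is u v ps)) p

-- The Cauchy–Schwarz inequality in a form that can be accumulated term by term

4mn≤[m+n]² : ∀ m n → 4 * (m * n) ≤ (m + n) * (m + n)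
4mn≤[m+n]² m n with ≤-total m n
... | inj₁ m≤n = subst (λ n → 4 * (m * n) ≤ (m + n) * (m + n)) (m+[n∸m]≡n m≤n)
                   (≤-trans (m≤m+n _ _) (≤-reflexive (lemma m (n ∸ m))))
  where
  lemma : ∀ m d → 4 * (m * (m + d)) + d * d ≡ (m + (m + d)) * (m + (m + d))
  lemma = solve-∀
... | inj₂ n≤m = subst (λ m → 4 * (m * n) ≤ (m + n) * (m + n)) (m+[n∸m]≡n n≤m)
                   (≤-trans (m≤m+n _ _) (≤-reflexive (lemma n (m ∸ n))))
  where
  lemma : ∀ n d → 4 * ((n + d) * n) + d * d ≡ ((n + d) + n) * ((n + d) + n)
  lemma = solve-∀

m²≤n²⇒m≤n : ∀ {m n} → m * m ≤ n * n → m ≤ n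
m²≤n²⇒m≤n m²≤n² = ≮⇒≥ λ n<m → <⇒≱ (*-mono-< n<m n<m) m²≤n²

-- The cross term `2 * (x * y)` is at most `a * f + b * e`: its square is at most 4(af)(be), and the
-- arithmetic-geometric mean inequality applies.
cauchy-schwarz : ∀ x y a b e f → x * x ≤ a * e → y * y ≤ b * f →
                 (x + y) * (x + y) ≤ (a + b) * (e + f)
cauchy-schwarz x y a b e f x²≤ y²≤ = begin
  (x + y) * (x + y)                   ≡⟨ expand x y ⟩
  x * x + y * y + 2 * (x * y)         ≤⟨ +-mono-≤ (+-mono-≤ x²≤ y²≤) (m²≤n²⇒m≤n cross) ⟩
  a * e + b * f + (a * f + b * e)     ≡⟨ collect a b e f ⟩
  (a + b) * (e + f)                   ∎
  where
  open ≤-Reasoning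
  expand : ∀ x y → (x + y) * (x + y) ≡ x * x + y * y + 2 * (x * y)
  expand = solve-∀
  collect : ∀ a b e f → a * e + b * f + (a * f + b * e) ≡ (a + b) * (e + f)
  collect = solve-∀
  square : ∀ x y → 2 * (x * y) * (2 * (x * y)) ≡ 4 * ((x * x) * (y * y))
  square = solve-∀
  regroup : ∀ a b e f → 4 * ((a * e) * (b * f)) ≡ 4 * ((a * f) * (b * e))
  regroup = solve-∀
  cross : 2 * (x * y) * (2 * (x * y)) ≤ (a * f + b * e) * (a * f + b * e)
  cross = begin
    2 * (x * y) * (2 * (x * y))        ≡⟨ square x y ⟩
    4 * ((x * x) * (y * y))            ≤⟨ *-monoʳ-≤ 4 (*-mono-≤ x²≤ y²≤) ⟩
    4 * ((a * e) * (b * f))            ≡⟨ regroup a b e f ⟩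
    4 * ((a * f) * (b * e))            ≤⟨ 4mn≤[m+n]² (a * f) (b * e) ⟩
    (a * f + b * e) * (a * f + b * e)  ∎

-- Multisets given by multiplicities

spread : (I → ℕ) → (I → Vec Bool n) → List I → List (Vec Bool n)
spread f u = concatMap (λ i → replicate (f i) (u i))

++-interchange : (ws xs ys zs : List (Vec Bool n)) →
                 (ws ++ xs) ++ (ys ++ zs) ↭ (ws ++ ys) ++ (xs ++ zs)
++-interchange {n} = interchange
  where
  open CommutativeSemigroupProperties
    (CommutativeMonoid.commutativeSemigroup (++-commutativeMonoid {A = Vec Bool n}))

replicate-+ : ∀ k l (x : I) → replicate (k + l) x ≡ replicate k x ++ replicate l x
replicate-+ zero    l x = refl
replicate-+ (suc k) l x = cong (x ∷_) (replicate-+ k l x)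

spread-+ : ∀ f g (u : I → Vec Bool n) is →
           spread (λ i → f i + g i) u is ↭ spread f u is ++ spread g u is
spread-+ f g u [] = ↭-refl
spread-+ f g u (i ∷ is) =
  ↭-trans (++⁺ (↭-reflexive (replicate-+ (f i) (g i) (u i))) (spread-+ f g u is))
    (++-interchange (replicate (f i) (u i)) (replicate (g i) (u i)) (spread f u is) (spread g u is))

spread-cong : ∀ {f g} (u : I → Vec Bool n) → (∀ i → f i ≡ g i) → ∀ is → spread f u is ≡ spread g u is
spread-cong u eq = concatMap-cong (λ i → cong (λ k → replicate k (u i)) (eq i))

length-spread : ∀ f (u : I → Vec Bool n) is → length (spread f u is) ≡ Σ[ is ] f
length-spread f u []       = refl
length-spread f u (i ∷ is) =
  ≡-trans (length-++ (replicate (f i) (u i))) (cong₂ _+_ (length-replicate (f i)) (length-spread f u is))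

map-spread : ∀ b f (u : I → Vec Bool n) is → map (b ∷_) (spread f u is) ≡ spread f ((b ∷_) ∘ u) is
map-spread b f u is =
  ≡-trans (map-concatMap (b ∷_) _ is) (concatMap-cong (λ i → map-replicate (b ∷_) (f i) (u i)) is)

spread-cube : ∀ r f (u : Vec Bool (suc r) → Vec Bool n) →
              spread f u (cube (suc r)) ≡
              spread (f ∘ (true ∷_)) (u ∘ (true ∷_)) (cube r) ++
              spread (f ∘ (false ∷_)) (u ∘ (false ∷_)) (cube r)
spread-cube r f u =
  ≡-trans (concatMap-++ _ (map (true ∷_) (cube r)) (map (false ∷_) (cube r)))
    (cong₂ _++_ (concatMap-map _ (true ∷_) (cube r)) (concatMap-map _ (false ∷_) (cube r)))

-- Averaging along coordinates

replicate-transport : ∀ {x y : Vec Bool n} → dist x y ≤ 1 → ∀ d →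
                      Transport (replicate d x) (replicate d y) d
replicate-transport {x = x} {y} x~y d = replicate d y , go d , ↭-refl
  where
  go : ∀ d → Aligned (replicate d x) (replicate d y) d
  go zero    = []
  go (suc d) = +-monoˡ-≤ d x~y ∷ go d

replicate-shift : ∀ {x y : Vec Bool n} → dist x y ≤ 1 → ∀ k d l →
                  Transport (replicate (k + d) x ++ replicate l y)
                            (replicate k x ++ replicate (d + l) y) d
replicate-shift {x = x} {y} x~y k d l rewrite replicate-+ k d x | replicate-+ d l y =
  Transport-resp (CommutativeMonoid.assoc ++-commutativeMonoid (replicate k x) (replicate d x) (replicate l y)) ↭-refl
    (Transport-weaken (≤-reflexive (+-identityʳ d))
      (Transport-++ (Transport-↭ {xs = replicate k x} ↭-refl)
        (Transport-++ (replicate-transport x~y d) (Transport-↭ {xs = replicate l y} ↭-refl))))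

-- With d points moved, the energy falls by exactly 2d² if a + b is even. If a + b is odd, rounding
-- changes this by 2d in one direction or the other, and d² ≤ 2d² - 2d + 1 explains the added 1.
replicate-halve : ∀ {x y : Vec Bool n} → dist x y ≤ 1 → ∀ a b → ∃ λ d →
  Transport (replicate a x ++ replicate b y)
            (replicate ⌊ a + b /2⌋ x ++ replicate ⌈ a + b /2⌉ y) d ×
  d * d + (⌊ a + b /2⌋ * ⌊ a + b /2⌋ + ⌈ a + b /2⌉ * ⌈ a + b /2⌉) ≤ (a * a + b * b) + 1
replicate-halve {x = x} {y} x~y a b =
  go a b ⌊ a + b /2⌋ ⌈ a + b /2⌉ (⌊n/2⌋+⌈n/2⌉≡n (a + b)) (⌊n/2⌋≤⌈n/2⌉ (a + b)) (⌊n/2⌋-mono (n≤1+n (suc (a + b))))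
  where
  assoc : ∀ h d b → (h + d) + b ≡ h + (d + b)
  assoc = solve-∀

  down : ∀ d h b → d + b ≤ suc h → d * d + (h * h + (d + b) * (d + b)) ≤ ((h + d) * (h + d) + b * b) + 1
  down zero h b le rewrite +-identityʳ h = m≤m+n _ _
  -- With d = e + 1 and h = e + b + t, the two sides differ by e² + 2(e + 1)t.
  down (suc e) h b le with m≤n⇒∃[o]m+o≡n (≤-pred le)
  ... | t , refl = ≤-trans (m≤m+n _ _) (≤-reflexive (lemma e b t))
    where
    lemma : ∀ e b t → (suc e * suc e + ((e + b + t) * (e + b + t) + (suc e + b) * (suc e + b))) + (e * e + 2 * suc e * t) ≡
                      ((e + b + t + suc e) * (e + b + t + suc e) + b * b) + 1
    lemma = solve-∀

  up : ∀ d a h′ → a + d ≤ h′ → d * d + ((a + d) * (a + d) + h′ * h′) ≤ (a * a + (d + h′) * (d + h′)) + 1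
  up d a h′ le with m≤n⇒∃[o]m+o≡n le
  ... | t , refl = ≤-trans (m≤m+n _ _) (≤-reflexive (lemma d a t))
    where
    lemma : ∀ d a t → (d * d + ((a + d) * (a + d) + (a + d + t) * (a + d + t))) + (d * d + 2 * d * t + 1) ≡
                      (a * a + (d + (a + d + t)) * (d + (a + d + t))) + 1
    lemma = solve-∀

  go : ∀ a b h h′ → h + h′ ≡ a + b → h ≤ h′ → h′ ≤ suc h → ∃ λ d →
       Transport (replicate a x ++ replicate b y) (replicate h x ++ replicate h′ y) d ×
       d * d + (h * h + h′ * h′) ≤ (a * a + b * b) + 1
  -- Points flow from x to y if a exceeds its share h, and from y to x otherwise; d = |a - h|.
  go a b h h′ eq h≤h′ h′≤1+h with ≤-total h a
  ... | inj₁ h≤a with m≤n⇒∃[o]m+o≡n h≤a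
  ... | d , refl with +-cancelˡ-≡ h h′ (d + b) (≡-trans eq (assoc h d b))
  ... | refl = d , replicate-shift x~y h d b , down d h b h′≤1+h
  go a b h h′ eq h≤h′ h′≤1+h | inj₂ a≤h with m≤n⇒∃[o]m+o≡n a≤h
  ... | d , refl with +-cancelˡ-≡ a b (d + h′) (≡-trans (sym eq) (assoc a d h′))
  ... | refl = d , Transport-sym (replicate-shift x~y a d h′) , up d a h′ h≤h′

-- All pairs are averaged in parallel. The number e is the sum of the squared moves: Cauchy-Schwarz
-- bounds the total D through it, and the drop in energy pays for it up to one unit of rounding per
-- pair.
spread-halve : ∀ {u v : I → Vec Bool n} → (∀ i → dist (u i) (v i) ≤ 1) → ∀ f g is →
  let h = λ i → ⌊ f i + g i /2⌋ ; h′ = λ i → ⌈ f i + g i /2⌉ in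
  ∃ λ D → ∃ λ e →
  Transport (spread f u is ++ spread g v is) (spread h u is ++ spread h′ v is) D ×
  D * D ≤ length is * e ×
  e + (Σ[ is ] (λ i → h i * h i) + Σ[ is ] (λ i → h′ i * h′ i)) ≤
    (Σ[ is ] (λ i → f i * f i) + Σ[ is ] (λ i → g i * g i)) + length is
spread-halve u~v f g [] = 0 , 0 , Transport-↭ ↭-refl , z≤n , z≤n
spread-halve {u = u} {v} u~v f g (i ∷ is)
  with replicate-halve (u~v i) (f i) (g i) | spread-halve u~v f g is
... | d , t , d²≤ | D , e , T , D²≤ , e≤ =
  d + D , d * d + e ,
  Transport-resp (++-interchange (replicate (f i) (u i)) _ (replicate (g i) (v i)) _)
                 (++-interchange (replicate ⌊ f i + g i /2⌋ (u i)) _ _ _)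
    (Transport-++ t T) ,
  cauchy-schwarz d D 1 (length is) (d * d) e (≤-reflexive (sym (+-identityʳ (d * d)))) D²≤ ,
  ≤-trans (≤-reflexive (regroup (d * d) e (h i * h i) (h′ i * h′ i) (Σ[ is ] (λ i → h i * h i)) (Σ[ is ] (λ i → h′ i * h′ i))))
    (≤-trans (+-mono-≤ d²≤ e≤) (≤-reflexive (collect (f i * f i) (g i * g i) (Σ[ is ] (λ i → f i * f i)) (Σ[ is ] (λ i → g i * g i)) (length is))))
  where
  h h′ : _ → ℕ
  h  i = ⌊ f i + g i /2⌋
  h′ i = ⌈ f i + g i /2⌉
  regroup : ∀ d e a b x y → (d + e) + ((a + x) + (b + y)) ≡ (d + (a + b)) + (e + (x + y))
  regroup = solve-∀
  collect : ∀ a b x y l → (a + b + 1) + (x + y + l) ≡ ((a + x) + (b + y)) + suc l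
  collect = solve-∀

Σ² : (Vec Bool r → ℕ) → ℕ
Σ² {r} f = Σ[ cube r ] (λ q → f q * f q)

-- The summand k passes through the halving intact, and rounding up instead of down costs at most
-- one. Hence the width in `flatten` grows by one per coordinate.
⌈n+2k/2⌉≤ : ∀ n k → ⌈ n + (k + k) /2⌉ ≤ ⌊ n /2⌋ + suc k
⌈n+2k/2⌉≤ n zero = ≤-trans (≤-reflexive (cong ⌈_/2⌉ (+-identityʳ n)))
  (≤-trans (⌊n/2⌋-mono (n≤1+n (suc n))) (≤-reflexive (+-comm 1 ⌊ n /2⌋)))
⌈n+2k/2⌉≤ n (suc k) rewrite +-suc k k | +-suc n (suc (k + k)) | +-suc n (k + k) | +-suc ⌊ n /2⌋ (suc k) =
  s≤s (⌈n+2k/2⌉≤ n k)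

NonExpansive : (Vec Bool r → Vec Bool n) → Set
NonExpansive u = ∀ p q → dist (u p) (u q) ≤ dist p q

-- Recursion on the first coordinate: each half is flattened to within r of a constant of its own,
-- then the halves are averaged against each other, and with them the constants. The weight
-- `r * 2 ^ r`, twice the number of edges, serves both as the Cauchy-Schwarz factor and as the
-- rounding allowance.
flatten : ∀ r (u : Vec Bool r → Vec Bool n) → NonExpansive u → ∀ f →
  ∃ λ g → ∃ λ D → ∃ λ e → ∃ λ L →
  Transport (spread f u (cube r)) (spread g u (cube r)) D ×
  D * D ≤ (r * 2 ^ r) * e ×
  e + Σ² g ≤ Σ² f + r * 2 ^ r ×
  (∀ q → L ≤ g q × g q ≤ L + r)
flatten zero u u-ne f =
  f , 0 , 0 , f [] , Transport-↭ ↭-refl , z≤n , m≤m+n _ _ ,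
  λ { [] → ≤-refl , ≤-reflexive (sym (+-identityʳ _)) }
flatten (suc r) u u-ne f
  with flatten r (u ∘ (true ∷_)) (λ p q → u-ne (true ∷ p) (true ∷ q)) (f ∘ (true ∷_))
     | flatten r (u ∘ (false ∷_)) (λ p q → u-ne (false ∷ p) (false ∷ q)) (f ∘ (false ∷_))
... | g₁ , D₁ , e₁ , L₁ , t₁ , D₁²≤ , e₁≤ , g₁-near | g₀ , D₀ , e₀ , L₀ , t₀ , D₀²≤ , e₀≤ , g₀-near
  -- Partners differ in the first coordinate alone, so non-expansiveness puts their images at
  -- distance at most one.
  with spread-halve (λ q → ≤-trans (u-ne (true ∷ q) (false ∷ q)) (≤-reflexive (cong suc (dist-refl q)))) g₁ g₀ (cube r)
... | D , e , t , D²≤ , e≤ =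
  g , (D₁ + D₀) + D , (e₁ + e₀) + e , ⌊ L₁ + L₀ /2⌋ ,
  Transport-resp (↭-reflexive (spread-cube r f u)) (↭-reflexive (sym (spread-cube r g u)))
    (Transport-trans (Transport-++ t₁ t₀) t) ,
  ≤-trans (cauchy-schwarz (D₁ + D₀) D (N + N) (length (cube r)) (e₁ + e₀) e
             (cauchy-schwarz D₁ D₀ N N e₁ e₀ D₁²≤ D₀²≤) D²≤)
          (*-monoˡ-≤ ((e₁ + e₀) + e) edges≤) ,
  energy ,
  near
  where
  open ≤-Reasoning
  N = r * 2 ^ r
  F₁ = Σ² (f ∘ (true ∷_))
  F₀ = Σ² (f ∘ (false ∷_))
  g : Vec Bool (suc r) → ℕ
  g (true ∷ q)  = ⌊ g₁ q + g₀ q /2⌋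
  g (false ∷ q) = ⌈ g₁ q + g₀ q /2⌉
  -- The two halves and the new direction use (2r + 1)2^r of the available (2r + 2)2^r.
  edges≤ : (N + N) + length (cube r) ≤ suc r * 2 ^ suc r
  edges≤ rewrite length-cube r = ≤-trans (m≤m+n _ (2 ^ r)) (≤-reflexive (lemma r (2 ^ r)))
    where
    lemma : ∀ r p → (r * p + r * p) + p + p ≡ suc r * (2 * p)
    lemma = solve-∀
  energy : ((e₁ + e₀) + e) + Σ² g ≤ Σ² f + suc r * 2 ^ suc r
  energy rewrite Σ-cube r (λ q → g q * g q) | Σ-cube r (λ q → f q * f q) = begin
    ((e₁ + e₀) + e) + _                        ≡⟨ +-assoc (e₁ + e₀) e _ ⟩
    (e₁ + e₀) + (e + _)                        ≤⟨ +-monoʳ-≤ (e₁ + e₀) e≤ ⟩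
    (e₁ + e₀) + ((Σ² g₁ + Σ² g₀) + length (cube r))    ≡⟨ regroup e₁ e₀ (Σ² g₁) (Σ² g₀) _ ⟩
    ((e₁ + Σ² g₁) + (e₀ + Σ² g₀)) + length (cube r)    ≤⟨ +-monoˡ-≤ (length (cube r)) (+-mono-≤ e₁≤ e₀≤) ⟩
    ((F₁ + N) + (F₀ + N)) + length (cube r)    ≡⟨ collect F₁ F₀ N (length (cube r)) ⟩
    (F₁ + F₀) + ((N + N) + length (cube r))   ≤⟨ +-monoʳ-≤ (F₁ + F₀) edges≤ ⟩
    (F₁ + F₀) + suc r * 2 ^ suc r ∎
    where
    regroup : ∀ a b x y l → (a + b) + ((x + y) + l) ≡ ((a + x) + (b + y)) + l
    regroup = solve-∀
    collect : ∀ a b n l → ((a + n) + (b + n)) + l ≡ (a + b) + ((n + n) + l)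
    collect = solve-∀
  lower : ∀ q → ⌊ L₁ + L₀ /2⌋ ≤ ⌊ g₁ q + g₀ q /2⌋
  lower q = ⌊n/2⌋-mono (+-mono-≤ (proj₁ (g₁-near q)) (proj₁ (g₀-near q)))
  upper : ∀ q → ⌈ g₁ q + g₀ q /2⌉ ≤ ⌊ L₁ + L₀ /2⌋ + suc r
  upper q = begin
    ⌈ g₁ q + g₀ q /2⌉             ≤⟨ ⌈n/2⌉-mono (+-mono-≤ (proj₂ (g₁-near q)) (proj₂ (g₀-near q))) ⟩
    ⌈ (L₁ + r) + (L₀ + r) /2⌉     ≡⟨ cong ⌈_/2⌉ (lemma L₁ L₀ r) ⟩
    ⌈ (L₁ + L₀) + (r + r) /2⌉     ≤⟨ ⌈n+2k/2⌉≤ (L₁ + L₀) r ⟩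
    ⌊ L₁ + L₀ /2⌋ + suc r         ∎
    where
    lemma : ∀ a b r → (a + r) + (b + r) ≡ (a + b) + (r + r)
    lemma = solve-∀
  near : ∀ q → ⌊ L₁ + L₀ /2⌋ ≤ g q × g q ≤ ⌊ L₁ + L₀ /2⌋ + suc r
  near (true ∷ q)  = lower q , ≤-trans (⌊n/2⌋≤⌈n/2⌉ (g₁ q + g₀ q)) (upper q)
  near (false ∷ q) = ≤-trans (lower q) (⌊n/2⌋≤⌈n/2⌉ (g₁ q + g₀ q)) , upper q

-- The pointwise minimum stays in place. As the totals agree, surplus and deficit are equally long;
-- they are matched arbitrarily at cost at most n per point, and the surplus has at most k points
-- per index.
rebalance : ∀ (u : I → Vec Bool n) is f g →
            length (spread f u is) ≡ length (spread g u is) → (∀ i → f i ≤ g i + k) →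
            Transport (spread f u is) (spread g u is) ((length is * k) * n)
rebalance {n = n} {k = k} u is f g eq f≤g+k =
  Transport-resp f↭ (↭-sym g↭)
    (Transport-weaken (*-monoˡ-≤ n surplus≤)
      (Transport-++ (Transport-↭ {xs = spread (λ i → f i ⊓ g i) u is} ↭-refl) (Transport-any _ _ surplus≡deficit)))
  where
  common surplus deficit : List (Vec Bool n)
  common  = spread (λ i → f i ⊓ g i) u is
  surplus = spread (λ i → f i ∸ g i) u is
  deficit = spread (λ i → g i ∸ f i) u is
  f↭ : spread f u is ↭ common ++ surplus
  f↭ = ↭-trans
    (↭-reflexive (spread-cong u (λ i → sym (≡-trans (cong (_+ (f i ∸ g i)) (⊓-comm (f i) (g i))) (m⊓n+n∸m≡n (g i) (f i)))) is))
    (spread-+ _ _ u is)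
  g↭ : spread g u is ↭ common ++ deficit
  g↭ = ↭-trans (↭-reflexive (spread-cong u (λ i → sym (m⊓n+n∸m≡n (f i) (g i))) is)) (spread-+ _ _ u is)
  surplus≡deficit : length surplus ≡ length deficit
  surplus≡deficit = +-cancelˡ-≡ (length common) _ _
    (≡-trans (sym (length-++ common)) (≡-trans (sym (↭-length f↭))
      (≡-trans eq (≡-trans (↭-length g↭) (length-++ common)))))
  surplus≤ : length surplus ≤ length is * k
  surplus≤ rewrite length-spread (λ i → f i ∸ g i) u is | sym (Σ-const is k) =
    Σ-mono is (λ i → m≤n+o⇒m∸n≤o (f i) (g i) (f≤g+k i))

-- Collapsing the last s coordinates

-- This drives the inductions on the dimension: both halves are again free of repetitions.
headSplit : (A : List (Vec Bool (suc n))) → Unique A → ∃ λ A₁ → ∃ λ A₀ →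
            A ↭ map (true ∷_) A₁ ++ map (false ∷_) A₀ × Unique A₁ × Unique A₀
headSplit [] [] = [] , [] , ↭-refl , [] , []
headSplit ((b ∷ x) ∷ A) (x∉A ∷ A!) with headSplit A A!
headSplit ((true ∷ x) ∷ A) (x∉A ∷ A!) | A₁ , A₀ , π , A₁! , A₀! =
  x ∷ A₁ , A₀ , prep _ π ,
  All.map (λ ne eq → ne (cong (true ∷_) eq)) (All.map⁻ (All.++⁻ˡ (map (true ∷_) A₁) (All-resp-↭ π x∉A))) ∷ A₁! , A₀!
headSplit ((false ∷ x) ∷ A) (x∉A ∷ A!) | A₁ , A₀ , π , A₁! , A₀! =
  A₁ , x ∷ A₀ , ↭-trans (prep _ π) (↭-sym (shift (false ∷ x) (map (true ∷_) A₁) (map (false ∷_) A₀))) ,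
  A₁! , All.map (λ ne eq → ne (cong (false ∷_) eq)) (All.map⁻ (All.++⁻ʳ (map (true ∷_) A₁) (All-resp-↭ π x∉A))) ∷ A₀!

length-headSplit : ∀ {A : List (Vec Bool (suc n))} A₁ A₀ →
                   A ↭ map (true ∷_) A₁ ++ map (false ∷_) A₀ → length A ≡ length A₁ + length A₀
length-headSplit A₁ A₀ π = ≡-trans (↭-length π)
  (≡-trans (length-++ (map (true ∷_) A₁)) (cong₂ _+_ (length-map _ A₁) (length-map _ A₀)))

Unique⇒length≤2^n : (A : List (Vec Bool n)) → Unique A → length A ≤ 2 ^ n
Unique⇒length≤2^n {zero} [] A! = z≤n
Unique⇒length≤2^n {zero} (x ∷ []) A! = ≤-refl
Unique⇒length≤2^n {zero} ([] ∷ [] ∷ A) ((ne ∷ _) ∷ A!) = ⊥-elim (ne refl)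
Unique⇒length≤2^n {suc n} A A! with headSplit A A!
... | A₁ , A₀ , π , A₁! , A₀! rewrite length-headSplit A₁ A₀ π | +-identityʳ (2 ^ n) =
  +-mono-≤ (Unique⇒length≤2^n A₁ A₁!) (Unique⇒length≤2^n A₀ A₀!)

-- A point of {0,1}^r stands for its fibre and is represented by the member of the fibre that ends
-- in zeros. A load on {0,1}^r thus remains a multiset in the large cube.
pad : ∀ s → Vec Bool r → Vec Bool (r + s)
pad s p = p Vec.++ Vec.replicate s false

pad-nonExpansive : ∀ r s → NonExpansive (pad {r} s)
pad-nonExpansive zero    s []      []      = ≤-reflexive (dist-refl (Vec.replicate s false))
pad-nonExpansive (suc r) s (a ∷ p) (b ∷ q) = +-monoʳ-≤ _ (pad-nonExpansive r s p q)

collapse : ∀ r s (A : List (Vec Bool (r + s))) → Unique A → ∃ λ f →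
           (∀ p → f p ≤ 2 ^ s) × Transport A (spread f (pad s) (cube r)) (length A * s)
-- A single fibre of dimension s remains: each point moves by at most s, and the absence of
-- repetitions bounds the load by 2^s.
collapse zero s A A! =
  const (length A) , const (Unique⇒length≤2^n A A!) ,
  Transport-any A _ (sym (≡-trans (length-spread {I = Vec Bool 0} (const (length A)) (pad s) ([] ∷ [])) (+-identityʳ _)))
collapse (suc r) s A A! with headSplit A A!
... | A₁ , A₀ , π , A₁! , A₀! with collapse r s A₁ A₁! | collapse r s A₀ A₀!
... | f₁ , f₁≤ , t₁ | f₀ , f₀≤ , t₀ =
  f , f≤ ,
  Transport-weaken (≤-reflexive cost)
    (Transport-resp π
      (↭-reflexive (≡-trans
        (cong₂ _++_ (map-spread true f₁ (pad s) (cube r)) (map-spread false f₀ (pad s) (cube r)))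
        (sym (spread-cube r f (pad s)))))
      (Transport-++ (Transport-∷ true t₁) (Transport-∷ false t₀)))
  where
  f : Vec Bool (suc r) → ℕ
  f (true ∷ p)  = f₁ p
  f (false ∷ p) = f₀ p
  f≤ : ∀ p → f p ≤ 2 ^ s
  f≤ (true ∷ p)  = f₁≤ p
  f≤ (false ∷ p) = f₀≤ p
  cost : length A₁ * s + length A₀ * s ≡ length A * s
  cost = ≡-trans (sym (*-distribʳ-+ s (length A₁) (length A₀))) (cong (_* s) (sym (length-headSplit A₁ A₀ π)))

-- Equally large subsets of the cube

isqrt : ∀ n → ∃ λ s → s * s ≤ n × n < suc s * suc s
isqrt zero = 0 , z≤n , s≤s z≤n
isqrt (suc n) with isqrt n
... | s , s²≤n , n<[1+s]² with ≤-total (suc s * suc s) (suc n)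
... | inj₁ le = suc s , le , ≤-<-trans n<[1+s]² (*-mono-< (n<1+n (suc s)) (n<1+n (suc s)))
... | inj₂ ge with m≤n⇒m<n∨m≡n ge
... | inj₁ lt = s , m≤n⇒m≤1+n s²≤n , lt
... | inj₂ eq = suc s , ≤-reflexive (sym eq) , ≤-<-trans (≤-reflexive eq) (*-mono-< (n<1+n (suc s)) (n<1+n (suc s)))

-- Exponential against polynomial growth

1+n≤2^n : ∀ n → suc n ≤ 2 ^ n
1+n≤2^n zero    = ≤-refl
1+n≤2^n (suc n) = ≤-trans (≤-reflexive (+-comm 1 (suc n)))
  (+-mono-≤ (1+n≤2^n n) (≤-trans (m^n>0 2 n) (≤-reflexive (sym (+-identityʳ (2 ^ n))))))

-- Equality holds at n = 3, which fixes the constant 8. From there on (n + 2)³ ≤ 2(n + 1)³ carries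
-- the induction.
[1+n]³≤8*2^n : ∀ n → suc n * suc n * suc n ≤ 8 * 2 ^ n
[1+n]³≤8*2^n 0 = ≤ᵇ⇒≤ _ _ _
[1+n]³≤8*2^n 1 = ≤ᵇ⇒≤ _ _ _
[1+n]³≤8*2^n 2 = ≤ᵇ⇒≤ _ _ _
[1+n]³≤8*2^n 3 = ≤ᵇ⇒≤ _ _ _
[1+n]³≤8*2^n (suc n@(suc (suc (suc j)))) = begin
  (5 + j) * (5 + j) * (5 + j)          ≤⟨ m≤m+n _ _ ⟩
  (5 + j) * (5 + j) * (5 + j) + (3 + 21 * j + 9 * (j * j) + j * j * j)
                                       ≡⟨ growth j ⟩
  2 * ((4 + j) * (4 + j) * (4 + j))    ≤⟨ *-monoʳ-≤ 2 ([1+n]³≤8*2^n n) ⟩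
  2 * (8 * 2 ^ (3 + j))                ≡⟨ comm (2 ^ (3 + j)) ⟩
  8 * 2 ^ (4 + j)                      ∎
  where
  open ≤-Reasoning
  growth : ∀ j → (5 + j) * (5 + j) * (5 + j) + (3 + 21 * j + 9 * (j * j) + j * j * j) ≡
                 2 * ((4 + j) * (4 + j) * (4 + j))
  growth = solve-∀
  comm : ∀ p → 2 * (8 * p) ≡ 8 * (2 * p)
  comm = solve-∀

-- This is n^(3/2) ≤ q³ ≤ m, squared to avoid roots.
n³≤m² : ∀ n q m → n ≤ q * q → q * q * q ≤ m → n * n * n ≤ m * m
n³≤m² n q m n≤q² q³≤m = begin
  n * n * n                        ≤⟨ *-mono-≤ (*-mono-≤ n≤q² n≤q²) n≤q² ⟩
  ((q * q) * (q * q)) * (q * q)    ≡⟨ lemma q ⟩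
  (q * q * q) * (q * q * q)        ≤⟨ *-mono-≤ q³≤m q³≤m ⟩
  m * m                            ∎
  where
  open ≤-Reasoning
  lemma : ∀ q → ((q * q) * (q * q)) * (q * q) ≡ (q * q * q) * (q * q * q)
  lemma = solve-∀

-- Inequalities x ≤ k√Q, squared to stay within the natural numbers

record _≤_√_ (x k Q : ℕ) : Set where
  constructor square≤
  field square : x * x ≤ (k * k) * Q

-- Cauchy-Schwarz applied to x² ≤ k(kQ) and y² ≤ l(lQ).
√-+ : ∀ {Q} x y k l → x ≤ k √ Q → y ≤ l √ Q → (x + y) ≤ (k + l) √ Q
√-+ {Q} x y k l (square≤ x²≤) (square≤ y²≤) = square≤ (≤-trans
  (cauchy-schwarz x y k l (k * Q) (l * Q)
    (≤-trans x²≤ (≤-reflexive (*-assoc k k Q))) (≤-trans y²≤ (≤-reflexive (*-assoc l l Q))))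
  (≤-reflexive (lemma k l Q)))
  where
  lemma : ∀ k l Q → (k + l) * (k * Q + l * Q) ≡ (k + l) * (k + l) * Q
  lemma = solve-∀

-- For passing from the whole cube with 2M points to a set of M points.
√-halve : ∀ {x} k n M → x ≤ k √ (n * (2 * M * (2 * M))) → x ≤ (2 * k) √ (n * (M * M))
√-halve k n M (square≤ x²≤) = square≤ (≤-trans x²≤ (≤-reflexive (lemma k n M)))
  where
  lemma : ∀ k n M → k * k * (n * (2 * M * (2 * M))) ≡ 2 * k * (2 * k) * (n * (M * M))
  lemma = solve-∀

√-scale : ∀ {x} k n M m → x ≤ k √ (n * (M * M)) → (m * x) * (m * x) ≤ (k * k) * n * ((m * M) * (m * M))
√-scale {x} k n M m (square≤ x²≤) = begin
  (m * x) * (m * x)                   ≡⟨ split m x ⟩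
  (m * m) * (x * x)                   ≤⟨ *-monoʳ-≤ (m * m) x²≤ ⟩
  (m * m) * (k * k * (n * (M * M)))   ≡⟨ collect k n m M ⟩
  (k * k) * n * ((m * M) * (m * M))   ∎
  where
  open ≤-Reasoning
  split : ∀ m x → (m * x) * (m * x) ≡ (m * m) * (x * x)
  split = solve-∀
  collect : ∀ k n m M → (m * m) * (k * k * (n * (M * M))) ≡ (k * k) * n * ((m * M) * (m * M))
  collect = solve-∀

-- Smoothing one set and comparing two smoothings

record Smoothing r s (A : List (Vec Bool (r + s))) : Set where
  constructor smoothing
  field
    load      : Vec Bool r → ℕ
    cost      : ℕ
    floor     : ℕ
    transport : Transport A (spread load (pad s) (cube r)) cost
    cost≤     : cost ≤ 3 √ ((r + s) * (2 ^ (r + s) * 2 ^ (r + s)))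
    near      : ∀ q → floor ≤ load q × load q ≤ floor + r

-- Of the constant 3 in `Smoothing`, forgetting s coordinates takes 1, because s ≤ √n, and averaging
-- takes 2.
smooth : ∀ r s → s * s ≤ r + s → r + s ≤ suc s * suc s →
         (A : List (Vec Bool (r + s))) → Unique A → Smoothing r s A
smooth r s s²≤ ≤[1+s]² A A! with collapse r s A A!
... | f , f≤ , t with flatten r (pad s) (pad-nonExpansive r s) f
... | g , D , e , L , t′ , D²≤ , e≤ , near =
  smoothing g (length A * s + D) L (Transport-trans t t′) (√-+ (length A * s) D 1 2 collapse≤ flatten≤) near
  where
  open ≤-Reasoning
  N = 2 ^ (r + s)
  P = 2 ^ r
  S = 2 ^ s
  N≡PS : N ≡ P * S
  N≡PS = ^-distribˡ-+-* 2 r s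
  collapse≤ : (length A * s) ≤ 1 √ ((r + s) * (N * N))
  collapse≤ = square≤ (begin
    (length A * s) * (length A * s)    ≤⟨ *-mono-≤ le le ⟩
    (N * s) * (N * s)                  ≡⟨ lemma N s ⟩
    (s * s) * (N * N)                  ≤⟨ *-monoˡ-≤ (N * N) s²≤ ⟩
    (r + s) * (N * N)                  ≡⟨ +-identityʳ _ ⟨
    1 * 1 * ((r + s) * (N * N))        ∎)
    where
    le : length A * s ≤ N * s
    le = *-monoˡ-≤ s (Unique⇒length≤2^n A A!)
    lemma : ∀ N s → (N * s) * (N * s) ≡ (s * s) * (N * N)
    lemma = solve-∀
  Σ²f≤ : Σ² f ≤ P * (S * S)
  Σ²f≤ = begin
    Σ² f                         ≤⟨ Σ-mono (cube r) (λ q → *-mono-≤ (f≤ q) (f≤ q)) ⟩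
    Σ[ cube r ] (const (S * S))  ≡⟨ Σ-const (cube r) (S * S) ⟩
    length (cube r) * (S * S)    ≡⟨ cong (_* (S * S)) (length-cube r) ⟩
    P * (S * S)                  ∎
  -- Rounding adds at most r·2^r to the energy; this keeps it below the bound 2^r·4^s on the initial
  -- energy.
  r≤S² : r ≤ S * S
  r≤S² = ≤-trans (m≤m+n r s) (≤-trans ≤[1+s]² (*-mono-≤ (1+n≤2^n s) (1+n≤2^n s)))
  flatten≤ : D ≤ 2 √ ((r + s) * (N * N))
  flatten≤ = square≤ (begin
    D * D                                  ≤⟨ D²≤ ⟩
    (r * P) * e                            ≤⟨ *-mono-≤ (*-monoˡ-≤ P (m≤m+n r s)) e≤2PSS ⟩
    -- The bound 2nN² is relaxed to 4nN², so that the constant is the integer 2 instead of √2.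
    ((r + s) * P) * (P * (S * S) + S * S * P)   ≤⟨ m≤m+n _ _ ⟩
    ((r + s) * P) * (P * (S * S) + S * S * P) + 2 * ((r + s) * ((P * S) * (P * S)))
                                           ≡⟨ lemma (r + s) P S ⟩
    2 * 2 * ((r + s) * ((P * S) * (P * S))) ≡⟨ cong (λ x → 2 * 2 * ((r + s) * (x * x))) N≡PS ⟨
    2 * 2 * ((r + s) * (N * N))            ∎)
    where
    e≤2PSS : e ≤ P * (S * S) + S * S * P
    e≤2PSS = ≤-trans (m≤m+n e (Σ² g)) (≤-trans e≤ (+-mono-≤ Σ²f≤ (*-monoˡ-≤ P r≤S²)))
    lemma : ∀ n P S → (n * P) * (P * (S * S) + S * S * P) + 2 * (n * ((P * S) * (P * S))) ≡
                      2 * 2 * (n * ((P * S) * (P * S)))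
    lemma = solve-∀

rebalance-cost : ∀ r n P S k → (r * r) * n ≤ (k * S) * (k * S) →
                 ((P * (r + r)) * n) ≤ (2 * k) √ (n * ((P * S) * (P * S)))
rebalance-cost r n P S k le = square≤ (begin
  (P * (r + r) * n) * (P * (r + r) * n)         ≡⟨ split P r n ⟩
  4 * n * (P * P) * ((r * r) * n)               ≤⟨ *-monoʳ-≤ (4 * n * (P * P)) le ⟩
  4 * n * (P * P) * ((k * S) * (k * S))         ≡⟨ collect k n P S ⟩
  2 * k * (2 * k) * (n * ((P * S) * (P * S)))   ∎)
  where
  open ≤-Reasoning
  split : ∀ P r n → (P * (r + r) * n) * (P * (r + r) * n) ≡ 4 * n * (P * P) * ((r * r) * n)
  split = solve-∀
  collect : ∀ k n P S → 4 * n * (P * P) * ((k * S) * (k * S)) ≡ 2 * k * (2 * k) * (n * ((P * S) * (P * S)))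
  collect = solve-∀

-- The route leads from A to its smoothing, across to that of B, and back to B. The constants are 3
-- + 16 + 3, with 16 twice the 8 from `[1+n]³≤8*2^n`.
smoothings-close : ∀ r s → r + s ≤ suc s * suc s →
  (A B : List (Vec Bool (r + s))) → length A ≡ length B → Smoothing r s A → Smoothing r s B →
  ∃ λ c → Transport A B c × c ≤ 22 √ ((r + s) * (2 ^ (r + s) * 2 ^ (r + s)))
smoothings-close r s ≤[1+s]² A B |A|≡|B|
  (smoothing g c L t c≤ g-near) (smoothing h d K t′ d≤ h-near) =
  (c + x) + d ,
  Transport-trans (Transport-trans t (rebalance {k = r + r} (pad s) (cube r) g h |g|≡|h| g≤h+2r)) (Transport-sym t′) ,
  √-+ (c + x) d 19 3 (√-+ c x 3 16 c≤ x≤) d≤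
  where
  open ≤-Reasoning
  N = 2 ^ (r + s)
  P = 2 ^ r
  S = 2 ^ s
  x = (length (cube r) * (r + r)) * (r + s)
  |g|≡|h| : length (spread g (pad s) (cube r)) ≡ length (spread h (pad s) (cube r))
  |g|≡|h| = ≡-trans (sym (Transport-length t)) (≡-trans |A|≡|B| (Transport-length t′))
  -- Equal totals mean equal averages: that of g is at least L, that of h at most K + r.
  L≤K+r : L ≤ K + r
  L≤K+r = *-cancelˡ-≤ P {{m^n≢0 2 r}} (begin
    P * L                          ≡⟨ cong (_* L) (length-cube r) ⟨
    length (cube r) * L            ≡⟨ Σ-const (cube r) L ⟨
    Σ[ cube r ] (const L)          ≤⟨ Σ-mono (cube r) (proj₁ ∘ g-near) ⟩
    Σ[ cube r ] g                  ≡⟨ length-spread g (pad s) (cube r) ⟨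
    length (spread g (pad s) (cube r)) ≡⟨ |g|≡|h| ⟩
    length (spread h (pad s) (cube r)) ≡⟨ length-spread h (pad s) (cube r) ⟩
    Σ[ cube r ] h                  ≤⟨ Σ-mono (cube r) (proj₂ ∘ h-near) ⟩
    Σ[ cube r ] (const (K + r))    ≡⟨ Σ-const (cube r) (K + r) ⟩
    length (cube r) * (K + r)      ≡⟨ cong (_* (K + r)) (length-cube r) ⟩
    P * (K + r)                    ∎)
  g≤h+2r : ∀ q → g q ≤ h q + (r + r)
  g≤h+2r q = begin
    g q              ≤⟨ proj₂ (g-near q) ⟩
    L + r            ≤⟨ +-monoˡ-≤ r L≤K+r ⟩
    K + r + r        ≤⟨ +-monoˡ-≤ r (+-monoˡ-≤ r (proj₁ (h-near q))) ⟩
    h q + r + r      ≡⟨ +-assoc (h q) r r ⟩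
    h q + (r + r)    ∎
  -- With n = r + s, r²n ≤ n³ ≤ (s + 1)⁶ ≤ (8·2^s)².
  r²n≤ : (r * r) * (r + s) ≤ (8 * S) * (8 * S)
  r²n≤ = ≤-trans (*-monoˡ-≤ (r + s) (*-mono-≤ (m≤m+n r s) (m≤m+n r s)))
    (n³≤m² (r + s) (suc s) (8 * S) ≤[1+s]² ([1+n]³≤8*2^n s))
  x≤ : x ≤ 16 √ ((r + s) * (N * N))
  x≤ = subst₂ (λ p N → ((p * (r + r)) * (r + s)) ≤ 16 √ ((r + s) * (N * N)))
    (sym (length-cube r)) (sym (^-distribˡ-+-* 2 r s)) (rebalance-cost r (r + s) P S 8 r²n≤)

equinumerous-close : ∀ n (A B : List (Vec Bool n)) → Unique A → Unique B → length A ≡ length B →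
                     ∃ λ c → Transport A B c × c ≤ 22 √ (n * (2 ^ n * 2 ^ n))
equinumerous-close n A B A! B! |A|≡|B| with isqrt n
-- For s = ⌊√n⌋, the inequality s ≤ s² ≤ n leaves r = n - s coordinates.
... | s , s²≤n , n<[1+s]² with m≤n⇒∃[o]m+o≡n (≤-trans (m≤m*m s) s²≤n)
  where
  m≤m*m : ∀ m → m ≤ m * m
  m≤m*m zero    = z≤n
  m≤m*m (suc m) = m≤m+n (suc m) _
... | r , s+r≡n with ≡-trans (+-comm r s) s+r≡n
... | refl = smoothings-close r s (<⇒≤ n<[1+s]²) A B |A|≡|B|
  (smooth r s s²≤n (<⇒≤ n<[1+s]²) A A!) (smooth r s s²≤n (<⇒≤ n<[1+s]²) B B!)

-- From a transport to a bijection

-- The list is halved just as `cube` is, so its entries become the values of φ in the order of the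
-- cube.
fromList : ∀ m (L : List I) → length L ≡ 2 ^ m → ∃ λ (φ : Vec Bool m → I) → map φ (cube m) ≡ L
fromList zero (a ∷ []) eq = const a , refl
fromList (suc m) L eq
  with fromList m (take (2 ^ m) L) take≡ | fromList m (drop (2 ^ m) L) drop≡
  where
  take≡ : length (take (2 ^ m) L) ≡ 2 ^ m
  take≡ = ≡-trans (length-take (2 ^ m) L) (m≤n⇒m⊓n≡m (≤-trans (m≤m+n (2 ^ m) _) (≤-reflexive (sym eq))))
  drop≡ : length (drop (2 ^ m) L) ≡ 2 ^ m
  drop≡ = ≡-trans (length-drop (2 ^ m) L)
    (≡-trans (cong (_∸ 2 ^ m) eq) (≡-trans (m+n∸m≡n (2 ^ m) _) (+-identityʳ (2 ^ m))))
... | φ₁ , eq₁ | φ₀ , eq₀ = φ , (begin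
  map φ (cube (suc m))
    ≡⟨ map-++ φ (map (true ∷_) (cube m)) (map (false ∷_) (cube m)) ⟩
  map φ (map (true ∷_) (cube m)) ++ map φ (map (false ∷_) (cube m))
    ≡⟨ cong₂ _++_ (map-∘ (cube m)) (map-∘ (cube m)) ⟨
  map φ₁ (cube m) ++ map φ₀ (cube m)
    ≡⟨ cong₂ _++_ eq₁ eq₀ ⟩
  take (2 ^ m) L ++ drop (2 ^ m) L
    ≡⟨ take++drop≡id (2 ^ m) L ⟩
  L ∎)
  where
  open ≡-Reasoning
  φ : Vec Bool (suc m) → _
  φ (true ∷ x)  = φ₁ x
  φ (false ∷ x) = φ₀ x

Unique-map-injective : ∀ (f : I → J) {is} → Unique (map f is) →
                       ∀ {i j} → i ∈ is → j ∈ is → f i ≡ f j → i ≡ j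
Unique-map-injective f (_ ∷ _)  (here refl) (here refl) eq = refl
Unique-map-injective f (ne ∷ _) (here refl) (there j∈)  eq = ⊥-elim (All.lookup ne (∈-map⁺ f j∈) eq)
Unique-map-injective f (ne ∷ _) (there i∈)  (here refl) eq = ⊥-elim (All.lookup ne (∈-map⁺ f i∈) (sym eq))
Unique-map-injective f (_ ∷ u)  (there i∈)  (there j∈)  eq = Unique-map-injective f u i∈ j∈ eq

cube-Unique : ∀ r → Unique (cube r)
cube-Unique zero = [] ∷ []
cube-Unique (suc r) = Unique.++⁺ (Unique.map⁺ (λ { refl → refl }) (cube-Unique r))
                                 (Unique.map⁺ (λ { refl → refl }) (cube-Unique r)) disjoint
  where
  disjoint : ∀ {x} → x ∈ map (true ∷_) (cube r) × x ∈ map (false ∷_) (cube r) → _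
  disjoint (p , q) with ∈-map⁻ (true ∷_) p | ∈-map⁻ (false ∷_) q
  ... | _ , _ , refl | _ , _ , ()

-- Each edge from x to y is compared with the path φ x, ι x, ι y, φ y. Every point is an end m times
-- in either role, hence the two copies of D; the middle step has length at most one and gives
-- `2 ^ m`.
stretchSum-≤ : ∀ m (φ ι : Vec Bool m → Vec Bool n) → NonExpansive ι →
  let D = Σ[ cube m ] (λ x → dist (ι x) (φ x)) in stretchSum φ ≤ m * ((D + D) + 2 ^ m)
stretchSum-≤ m φ ι ι-ne = begin
  stretchSum φ
    ≤⟨ Σ-mono (cube m) (λ x → Σ-mono (allFin m) (step x)) ⟩
  Σ[ cube m ] (λ x → Σ[ allFin m ] (λ i → (h x + 1) + h (flipAt i x)))
    ≡⟨ Σ-cong (cube m) (λ x → Σ-+ (allFin m) (λ _ → h x + 1) (λ i → h (flipAt i x))) ⟩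
  Σ[ cube m ] (λ x → Σ[ allFin m ] (λ _ → h x + 1) + Σ[ allFin m ] (λ i → h (flipAt i x)))
    ≡⟨ Σ-+ (cube m) _ _ ⟩
  Σ[ cube m ] (λ x → Σ[ allFin m ] (λ _ → h x + 1)) + Σ[ cube m ] (λ x → Σ[ allFin m ] (λ i → h (flipAt i x)))
    ≡⟨ cong₂ _+_ (Σ-swap (cube m) (allFin m) _) (Σ-swap (cube m) (allFin m) _) ⟩
  Σ[ allFin m ] (λ _ → Σ[ cube m ] (λ x → h x + 1)) + Σ[ allFin m ] (λ i → Σ[ cube m ] (h ∘ flipAt i))
    ≡⟨ cong₂ _+_ (Σ-allFin _) (≡-trans (Σ-cong (allFin m) (λ i → Σ-flipAt i h)) (Σ-allFin D)) ⟩
  m * Σ[ cube m ] (λ x → h x + 1) + m * D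
    ≡⟨ cong (λ y → m * y + m * D) (Σ-+ (cube m) h (const 1)) ⟩
  m * (D + Σ[ cube m ] (const 1)) + m * D
    ≡⟨ cong (λ y → m * (D + y) + m * D) (≡-trans (Σ-const (cube m) 1) (≡-trans (*-identityʳ _) (length-cube m))) ⟩
  m * (D + 2 ^ m) + m * D
    ≡⟨ collect m D (2 ^ m) ⟩
  m * ((D + D) + 2 ^ m) ∎
  where
  open ≤-Reasoning
  h : Vec Bool m → ℕ
  h x = dist (ι x) (φ x)
  D = Σ[ cube m ] h
  Σ-allFin : ∀ c → Σ[ allFin m ] (const c) ≡ m * c
  Σ-allFin c = ≡-trans (Σ-const (allFin m) c) (cong (_* c) (length-tabulate {n = m} (λ i → i)))
  collect : ∀ m D P → m * (D + P) + m * D ≡ m * ((D + D) + P)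
  collect = solve-∀
  step : ∀ x i → dist (φ x) (φ (flipAt i x)) ≤ (h x + 1) + h (flipAt i x)
  step x i = begin
    dist (φ x) (φ y)                                  ≤⟨ dist-triangle (φ x) (ι y) (φ y) ⟩
    dist (φ x) (ι y) + h y                            ≤⟨ +-monoˡ-≤ (h y) (dist-triangle (φ x) (ι x) (ι y)) ⟩
    (dist (φ x) (ι x) + dist (ι x) (ι y)) + h y       ≤⟨ +-monoˡ-≤ (h y) (+-mono-≤ (≤-reflexive (dist-sym (φ x) (ι x)))
                                                           (≤-trans (ι-ne x y) (≤-reflexive (dist-flipAt i x)))) ⟩
    (h x + 1) + h y                                   ∎
    where y = flipAt i x

-- Here n = m + 1. The bound on the average is squared and cleared of its denominator `m * 2 ^ m`.
theorem1 : Σ ℕ λ C → 0 < C ×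
    ((m : ℕ) → (A : List (Vec Bool (suc m))) → Unique A → length A ≡ 2 ^ m →
    Σ (Vec Bool m → Vec Bool (suc m)) λ φ →
    ((x : Vec Bool m) → φ x ∈ A) ×
    ((x y : Vec Bool m) → φ x ≡ φ y → x ≡ y) ×
    ((a : Vec Bool (suc m)) → a ∈ A → ∃ λ x → φ x ≡ a) ×
    (stretchSum φ * stretchSum φ ≤ (C * C) * suc m * ((m * 2 ^ m) * (m * 2 ^ m))))
-- 89 = 44 + 44 + 1: an edge pays for the transport at both ends and for its own length. The 44 is
-- 22 doubled, since 2^(m+1) = 2·2^m.
theorem1 = 89 , s≤s z≤n , bijection
  where
  bijection : (m : ℕ) → (A : List (Vec Bool (suc m))) → Unique A → length A ≡ 2 ^ m →
    Σ (Vec Bool m → Vec Bool (suc m)) λ φ →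
    ((x : Vec Bool m) → φ x ∈ A) ×
    ((x y : Vec Bool m) → φ x ≡ φ y → x ≡ y) ×
    ((a : Vec Bool (suc m)) → a ∈ A → ∃ λ x → φ x ≡ a) ×
    (stretchSum φ * stretchSum φ ≤ (89 * 89) * suc m * ((m * 2 ^ m) * (m * 2 ^ m)))
  bijection m A A! |A|≡2^m
    with equinumerous-close (suc m) (map (false ∷_) (cube m)) A
           (Unique.map⁺ (λ { refl → refl }) (cube-Unique m)) A!
           (≡-trans (length-map _ (cube m)) (≡-trans (length-cube m) (sym |A|≡2^m)))
  ... | c , (A′ , aligned , π) , c≤ with fromList m A′ (≡-trans (↭-length π) |A|≡2^m)
  -- Reading the matched list in cube order pairs `false ∷ x` with `φ x`; as the list is a
  -- permutation of A, φ is a bijection onto A.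
  ... | φ , refl =
    φ ,
    (λ x → ∈-resp-↭ π (∈-map⁺ φ (∈-cube x))) ,
    (λ x y → Unique-map-injective φ φ! (∈-cube x) (∈-cube y)) ,
    (λ a a∈A → let x , _ , eq = ∈-map⁻ φ (∈-resp-↭ (↭-sym π) a∈A) in x , sym eq) ,
    stretch≤
    where
    M = 2 ^ m
    X = (c + c) + M
    φ! : Unique (map φ (cube m))
    φ! = PermutationSetoid.Unique-resp-↭ (setoid _) (↭⇒↭ₛ (↭-sym π)) A!
    c≤44 : c ≤ 44 √ (suc m * (M * M))
    c≤44 = √-halve 22 (suc m) M c≤
    M≤1 : M ≤ 1 √ (suc m * (M * M))
    M≤1 = square≤ (≤-trans (m≤m+n (M * M) _) (≤-reflexive (sym (+-identityʳ _))))
    X≤89 : X ≤ 89 √ (suc m * (M * M))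
    X≤89 = √-+ (c + c) M 88 1 (√-+ c c 44 44 c≤44 c≤44) M≤1
    sum≤c : Σ[ cube m ] (λ x → dist (false ∷ x) (φ x)) ≤ c
    sum≤c = Aligned-Σ (cube m) (false ∷_) φ aligned
    mX≤ : stretchSum φ ≤ m * X
    mX≤ = ≤-trans (stretchSum-≤ m φ (false ∷_) (λ p q → ≤-refl))
      (*-monoʳ-≤ m (+-monoˡ-≤ M (+-mono-≤ sum≤c sum≤c)))
    stretch≤ : stretchSum φ * stretchSum φ ≤ (89 * 89) * suc m * ((m * M) * (m * M))
    stretch≤ = ≤-trans (*-mono-≤ mX≤ mX≤) (√-scale 89 (suc m) M m X≤89)
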